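{- For all integers $g\ge 3$ and $k\ge 1$, there exists a finite collection $\mathcal{B}$ of axis-aligned boxes in $\mathbb{R}^3$ whose intersection graph has girth at least $g$ and chromatic number at least $k$.
   Context: An axis-aligned box in $\mathbb{R}^3$ is a set of the form $[a_1,b_1]\times[a_2,b_2]\times[a_3,b_3]$ with real numbers $a_i\le b_i$. The intersection graph of a collection of sets is the simple graph whose vertices are the sets of the collection, two distinct sets being adjacent if and only if they have non-empty intersection. The girth of a graph is the length of its shortest cycle ($\infty$ if the graph has no cycle). -}

module Defs where

open import Data.Fin.Base using (Fin; zero; suc; inject₁; fromℕ)
open import Data.Nat.Base as ℕ using (ℕ)
open import Data.Product.Base using (_×_; _,_; ∃-syntax)
open import Data.Rational.Base as ℚ using (ℚ)
open import Data.Sum.Base using (_⊎_)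
open import Data.Vec.Functional using (Vector)
open import Function.Base using (_∘_)
open import Function.Definitions using (Injective)
open import Level using (Level; 0ℓ; _⊔_) renaming (suc to lsuc)
open import Relation.Binary.Definitions using (Symmetric; Irreflexive)
open import Relation.Binary.PropositionalEquality using (_≡_; _≢_; sym)
open import Relation.Nullary.Negation using (¬_)
open import Relation.Unary using (Pred; Satisfiable; _⊆_; _≐_; _≬_)
open import Relation.Unary.Properties using (≬-sym)

private
  variable
    v a ℓ : Level

-- Two-sided Dedekind cuts of ℚ. Two cuts are the same real number when each
-- is ≤ the other; propositional equality of cuts is never used.
record ℝ : Set₁ where
  field
    L U         : Pred ℚ 0ℓ
    L-inhabited : Satisfiable L
    U-inhabited : Satisfiable U
    L-lower     : ∀ {q r} → q ℚ.< r → L r → L q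
    U-upper     : ∀ {q r} → q ℚ.< r → U q → U r
    L-open      : ∀ {q} → L q → ∃[ r ] (q ℚ.< r × L r)
    U-open      : ∀ {r} → U r → ∃[ q ] (q ℚ.< r × U q)
    disjoint    : ∀ {q} → L q → ¬ U q
    located     : ∀ {q r} → q ℚ.< r → L q ⊎ U r

infix 4 _≤ᴿ_

_≤ᴿ_ : ℝ → ℝ → Set
x ≤ᴿ y = ℝ.L x ⊆ ℝ.L y

ℝ³ : Set₁
ℝ³ = Vector ℝ 3

record Box : Set₁ where
  field
    lower upper : ℝ³
    lower≤upper : ∀ i → lower i ≤ᴿ upper i

⟦_⟧ : Box → Pred ℝ³ 0ℓ
⟦ B ⟧ x = ∀ i → Box.lower B i ≤ᴿ x i × x i ≤ᴿ Box.upper B i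

-- A finite collection is a set of boxes, so different indices must carry
-- boxes that are different as subsets of ℝ³.
record BoxCollection : Set₁ where
  field
    size     : ℕ
    box      : Fin size → Box
    distinct : Injective _≡_ _≐_ (⟦_⟧ ∘ box)

record SimpleGraph (V : Set v) (ℓ : Level) : Set (v ⊔ lsuc ℓ) where
  field
    Adj    : V → V → Set ℓ
    symm   : Symmetric Adj
    irrefl : Irreflexive _≡_ Adj

intersectionGraph : {I : Set v} {X : Set a} → (I → Pred X ℓ) → SimpleGraph I (v ⊔ a ⊔ ℓ)
intersectionGraph S = record
  { Adj    = λ i j → i ≢ j × S i ≬ S j
  ; symm   = λ (i≢j , Si≬Sj) → i≢j ∘ sym , ≬-sym Si≬Sj
  ; irrefl = λ i≡j (i≢j , _) → i≢j i≡j
  }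

boxGraph : (𝓑 : BoxCollection) → SimpleGraph (Fin (BoxCollection.size 𝓑)) (lsuc 0ℓ)
boxGraph 𝓑 = intersectionGraph (⟦_⟧ ∘ BoxCollection.box 𝓑)

module _ {V : Set v} (G : SimpleGraph V ℓ) where
  open SimpleGraph G

  record Cycle : Set (v ⊔ ℓ) where
    field
      m         : ℕ
      vertex    : Fin (ℕ.suc m) → V
      injective : Injective _≡_ _≡_ vertex
      step      : ∀ (i : Fin m) → Adj (vertex (inject₁ i)) (vertex (suc i))
      close     : Adj (vertex (fromℕ m)) (vertex zero)

    length : ℕ
    length = ℕ.suc m

    field
      3≤length : 3 ℕ.≤ length

  record Colouring (c : ℕ) : Set (v ⊔ ℓ) where
    field
      colour : V → Fin c
      proper : ∀ {x y} → Adj x y → colour x ≢ colour y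

  -- The girth is the infimum in ℕ ∪ {∞} of the lengths of the cycles, so it
  -- is at least g exactly when g is a lower bound of those lengths.
  Girth≥ : ℕ → Set (v ⊔ ℓ)
  Girth≥ g = (C : Cycle) → g ℕ.≤ Cycle.length C

  -- Likewise for the chromatic number, the least c admitting a proper
  -- colouring with c colours.
  ChromaticNumber≥ : ℕ → Set (v ⊔ ℓ)
  ChromaticNumber≥ k = ∀ c → Colouring c → k ℕ.≤ c

{-# OPTIONS --safe #-}
module Submission where

-- Tutte's construction: if G needs more than c colours and H is a hypergraph
-- of large girth such that every (c+1)-colouring of its vertices has a
-- monochromatic edge, hang a copy of G on each edge of H, joining its vertices
-- to those of the edge. The result needs more than c+1 colours and still has
-- large girth. Boxes can follow it because a box [a , x] × J × [x , b] meets
-- the diagonal of the first and third coordinates at x only: the vertices of H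
-- become lines over points of the diagonal, and each copy of G lives in a thin
-- layer J of its own, after a monotone change of its outer coordinates that
-- moves its corners to the right lines. Such hypergraphs H come from the
-- Nešetřil–Rödl partite construction, which increases the girth by gluing
-- copies of a partite hypergraph along a hypergraph of smaller girth.

open import Defs
open import Data.Empty using (⊥; ⊥-elim)
open import Data.Fin.Base as Fin using (Fin; toℕ; combine; finToFun; funToFin; punchOut)
open import Data.Fin.Induction using (<-weakInduction)
open import Data.Fin.Patterns using (0F; 1F; 2F)
import Data.Fin.Properties as Fin
open import Data.Fin.Properties
  using (+↔⊎; *↔×; 0↔⊥; all?; any?; ¬∀⟶∃¬; ≤fromℕ; toℕ<n; toℕ-injective; toℕ-fromℕ; toℕ-fromℕ<;
         toℕ-inject₁; toℕ-combine; combine-injective; combine-injectiveˡ; combine-injectiveʳ;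
         combine-monoˡ-<; finToFun-funToFin; inject≤-injective; punchIn-punchOut; punchOut-injective)
open import Data.Integer.Base as ℤ using (+_; -[1+_]; -<+; +<+; +≤+)
import Data.Integer.Properties as ℤ
open import Data.Nat.Base using (ℕ; zero; suc; _+_; _*_; _^_; _⊔_; _≤_; _<_; z≤n; s≤s; s≤s⁻¹)
import Data.Nat.Properties as ℕ
open import Data.Product.Base using (Σ; _×_; _,_; ∃-syntax; proj₁; proj₂; swap)
open import Data.Product.Function.NonDependent.Propositional using (_×-↔_)
open import Data.Rational.Base as ℚ using (*<*; *≤*)
open import Data.Rational.Literals using (fromℤ)
import Data.Rational.Properties as ℚ
open import Data.Sum.Base using (_⊎_; inj₁; inj₂; reduce)
open import Data.Sum.Function.Propositional using (_⊎-↔_)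
open import Data.Sum.Properties using (inj₁-injective; inj₂-injective)
open import Data.Unit.Base using (⊤; tt)
open import Function.Base using (_∘_; case_of_; id)
open import Function.Bundles using (_↔_; Inverse; Injection)
open import Function.Definitions using (Injective)
open import Function.Properties.Inverse using (↔-refl; ↔-sym; ↔-trans; ↔⇒↣)
open import Level using (0ℓ)
open import Relation.Binary.Core using (Rel; REL)
open import Relation.Binary.Definitions using (tri<; tri≈; tri>; DecidableEquality)
open import Relation.Binary.PropositionalEquality
open import Relation.Nullary using (¬_; Dec; yes; no; contradiction)
open import Relation.Nullary.Decidable using (via-injection)
open import Relation.Unary using (Pred; Decidable)

-- Closed walks in glued graphs

-- Reduced walks from a: consecutive edges differ, and Walk _~_ a p q n has
-- length n and last step p ~ q. A closed one may backtrack at its base point.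
data Walk {V : Set} (_~_ : Rel V 0ℓ) (a : V) : V → V → ℕ → Set where
  first : ∀ {q} → a ~ q → Walk _~_ a a q 1
  next  : ∀ {p q r n} → Walk _~_ a p q n → q ~ r → r ≢ p → Walk _~_ a q r (suc n)

-- For a symmetric irreflexive relation this is girth greater than `l`: a closed reduced walk
-- contains a cycle that is no longer.
NoClosedWalk≤ : {V : Set} → Rel V 0ℓ → ℕ → Set
NoClosedWalk≤ _~_ l = ∀ {a p n} → Walk _~_ a p a n → l < n

1≤length : ∀ {V : Set} {_~_ : Rel V 0ℓ} {a p q n} → Walk _~_ a p q n → 1 ≤ n
1≤length (first _)    = ℕ.≤-refl
1≤length (next _ _ _) = s≤s z≤n

-- The bipartite incidence graph, whose closed walks measure the girth of a hypergraph.
data Incidence {Y E : Set} (_∈_ : REL Y E 0ℓ) : Rel (Y ⊎ E) 0ℓ where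
  into : ∀ {y e} → y ∈ e → Incidence _∈_ (inj₁ y) (inj₂ e)
  from : ∀ {y e} → y ∈ e → Incidence _∈_ (inj₂ e) (inj₁ y)

-- Copies ι e of the graph (V , _~_) indexed by hyperedges e, where two copies
-- may only meet in images of S, and do so as prescribed by the hypergraph.
record Gluing {V V′ Y E : Set} (_~_ : Rel V 0ℓ) (_~′_ : Rel V′ 0ℓ)
              (_∈_ : REL Y E 0ℓ) : Set₁ where
  field
    S        : Pred V 0ℓ
    S?       : Decidable S
    _≟_      : DecidableEquality E
    ι        : E → V → V′
    h        : E → V → Y
    ι-inj    : ∀ {e u v} → ι e u ≡ ι e v → u ≡ v
    h-inj    : ∀ {e u v} → S u → S v → h e u ≡ h e v → u ≡ v
    edge     : ∀ {p q} → p ~′ q → ∃[ e ] ∃[ u ] ∃[ v ] (p ≡ ι e u × q ≡ ι e v × u ~ v)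
    h-∈      : ∀ {e u} → S u → h e u ∈ e
    cross    : ∀ {e f u v} → e ≢ f → ι e u ≡ ι f v → S u × S v × h e u ≡ h f v
    S-apart  : ∀ {u v} → S u → S v → ¬ u ~ v
    S-far    : ∀ {u v w} → S u → S v → u ~ w → w ~ v → u ≡ v

module _ {V V′ Y E : Set} {_~_ : Rel V 0ℓ} {_~′_ : Rel V′ 0ℓ} {_∈_ : REL Y E 0ℓ}
         (𝒢 : Gluing _~_ _~′_ _∈_) (l : ℕ)
         (sparse : NoClosedWalk≤ (Incidence _∈_) l)
         (sparse-copy : NoClosedWalk≤ _~_ (suc l)) where
  open Gluing 𝒢

  private
    _⟷_ : Rel (Y ⊎ E) 0ℓ
    _⟷_ = Incidence _∈_

  -- The shadow in Y ⊎ E of a walk from a up to the moment, after n steps, when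
  -- it last entered the copy e, at x. The shadow is shorter than the walk
  -- because crossing a copy takes at least three steps but has a shadow of two.
  data Entry (a : V′) (b : Y ⊎ E) (e : E) (x : V) : ℕ → Set where
    initial : ¬ S x → a ≡ ι e x → b ≡ inj₂ e → Entry a b e x 0
    later   : ∀ {k n} → S x → Walk _⟷_ b (inj₁ (h e x)) (inj₂ e) k → k ≤ suc n →
              (b ≡ inj₂ e → k ≤ n) → Entry a b e x n

  -- The shadow starts at a hypergraph vertex if `a` is shared, and otherwise at the hyperedge of
  -- the only copy that contains `a`.
  data Base (a : V′) : Y ⊎ E → Set where
    shared  : ∀ {e s} → S s → a ≡ ι e s → Base a (inj₁ (h e s))
    own     : ∀ {e x} → ¬ S x → a ≡ ι e x → Base a (inj₂ e)

  record State (a p q : V′) (n : ℕ) : Set where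
    field
      {b}   : Y ⊎ E
      {e}   : E
      {x u v} : V
      {m t} : ℕ
      base  : Base a b
      entry : Entry a b e x m
      p≡    : p ≡ ι e u
      q≡    : q ≡ ι e v
      walk  : Walk _~_ x u v t
      n≡    : n ≡ m + t

  crossing≥3 : ∀ {x u v t} → S x → S v → x ≢ v → Walk _~_ x u v t → 3 ≤ t
  crossing≥3 Sx Sv x≢v (first x~v) = contradiction x~v (S-apart Sx Sv)
  crossing≥3 Sx Sv x≢v (next (first x~w) w~v _) = contradiction (S-far Sx Sv x~w w~v) x≢v
  crossing≥3 Sx Sv x≢v (next (next (first _) _ _) _ _) = ℕ.≤-refl
  crossing≥3 Sx Sv x≢v (next (next (next _ _ _) _ _) _ _) = s≤s (s≤s (s≤s z≤n))

  shadow≤ : ∀ {k m t} → k ≤ suc m → 3 ≤ t → suc (suc k) ≤ m + t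
  shadow≤ {m = m} k≤ 3≤t =
    ℕ.≤-trans (s≤s (s≤s k≤)) (ℕ.≤-trans (ℕ.≤-reflexive (ℕ.+-comm 3 m)) (ℕ.+-monoʳ-≤ m 3≤t))

  -- Returning to the entry point would close a walk inside a single copy, against `sparse-copy`.
  open-ended : ∀ {x u v m t} → Walk _~_ x u v t → m + t ≤ suc l → x ≢ v
  open-ended {m = m} w m+t≤l refl = ℕ.<⇒≱ (sparse-copy w) (ℕ.≤-trans (ℕ.m≤n+m _ m) m+t≤l)

  -- The shadow gains two steps, through `h e v` to `f`. It stays reduced: `e` and `f` differ, and
  -- so do the vertices where the walk enters and leaves `e`, since `h e` is injective on `S`.
  advance : ∀ {a b e f x u v v₂ m t} → Entry a b e x m → Walk _~_ x u v t →
            m + t ≤ suc l → e ≢ f → S v → S v₂ → h e v ≡ h f v₂ →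
            Entry a b f v₂ (m + t)
  advance (initial ¬Sx a≡ refl) w _ e≢f Sv Sv₂ eq =
    later Sv₂ (next (first (subst (λ y → inj₂ _ ⟷ inj₁ y) eq (from (h-∈ Sv))))
                    (into (h-∈ Sv₂)) (e≢f ∘ sym ∘ inj₂-injective))
          (s≤s (1≤length w)) (λ eq → contradiction (inj₂-injective eq) e≢f)
  advance {m = m} (later Sx R k≤ _) w bound e≢f Sv Sv₂ eq =
    later Sv₂ (next (next R (subst (λ y → inj₂ _ ⟷ inj₁ y) eq (from (h-∈ Sv)))
                            λ q → x≢v (h-inj Sx Sv (sym (trans eq (inj₁-injective q)))))
                    (into (h-∈ Sv₂)) (e≢f ∘ sym ∘ inj₂-injective))
          (ℕ.m≤n⇒m≤1+n fits) (λ _ → fits)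
    where
    x≢v = open-ended {m = m} w bound
    fits = shadow≤ k≤ (crossing≥3 Sx Sv x≢v w)

  state : ∀ {a p q n} → Walk _~′_ a p q n → n ≤ suc l → State a p q n
  state (first a~q) _ with edge a~q
  ... | e , x , v , refl , refl , x~v with S? x
  ...   | yes Sx = record
    { base = shared Sx refl ; p≡ = refl ; q≡ = refl ; walk = first x~v ; n≡ = refl
    ; entry = later Sx (first (into (h-∈ Sx))) ℕ.≤-refl λ () }
  ...   | no ¬Sx = record
    { base = own ¬Sx refl ; p≡ = refl ; q≡ = refl ; walk = first x~v ; n≡ = refl
    ; entry = initial ¬Sx refl refl }
  state (next w q~r r≢p) bound with state w (ℕ.<⇒≤ bound) | edge q~r
  ... | record { e = e ; m = m ; t = t ; base = base ; entry = entry
             ; p≡ = refl ; q≡ = refl ; walk = T ; n≡ = refl }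
      | f , v₂ , w′ , q≡′ , refl , v₂~w with e ≟ f
  ...   | yes refl with refl ← ι-inj q≡′ = record
    { base = base ; entry = entry ; p≡ = refl ; q≡ = refl
    ; walk = next T v₂~w (r≢p ∘ cong (ι e)) ; n≡ = sym (ℕ.+-suc m t) }
  ...   | no e≢f with Sv , Sv₂ , eq ← cross e≢f q≡′ = record
    { base = base ; entry = advance entry T (ℕ.<⇒≤ bound) e≢f Sv Sv₂ eq
    ; p≡ = q≡′ ; q≡ = refl ; walk = first v₂~w ; n≡ = ℕ.+-comm 1 (m + t) }

  meet : ∀ {e f u v} → S u → ι e u ≡ ι f v → S v × h e u ≡ h f v
  meet {e} {f} Su eq with e ≟ f
  ... | yes refl with refl ← ι-inj eq = Su , refl
  ... | no e≢f with _ , Sv , h≡ ← cross e≢f eq = Sv , h≡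

  -- If the walk never left its first copy, it closes up there. If `a` is shared, one more step
  -- closes the shadow. If `a` is not shared, the walk must be back in the copy it started from, so
  -- the shadow is already closed and the sharper bound in `later` applies.
  not-closed : ∀ {a p n} → State a p a n → n ≤ suc l → ⊥
  not-closed record { entry = initial _ a≡x _ ; q≡ = a≡v ; walk = T ; m = m ; n≡ = refl } bound =
    open-ended {m = m} T bound (ι-inj (trans (sym a≡x) a≡v))
  not-closed record { base = shared Ss a≡s ; m = m
                    ; entry = later Sx R k≤ _ ; q≡ = a≡v ; walk = T ; n≡ = refl } bound
    with Sv , h≡ ← meet Ss (trans (sym a≡s) a≡v) =
    ℕ.<⇒≱ (sparse (next R (subst (λ y → inj₂ _ ⟷ inj₁ y) (sym h≡) (from (h-∈ Sv)))
                    λ q → x≢v (h-inj Sx Sv (sym (trans (sym h≡) (inj₁-injective q))))))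
          (s≤s⁻¹ (ℕ.≤-trans fits bound))
    where
    x≢v = open-ended {m = m} T bound
    fits = shadow≤ k≤ (crossing≥3 Sx (proj₁ (meet Ss (trans (sym a≡s) a≡v))) x≢v T)
  not-closed record { base = own {e₀} ¬Sx a≡x ; e = e ; m = m
                    ; entry = later Sx R _ k≤ ; q≡ = a≡v ; walk = T ; n≡ = refl } bound
    with e₀ ≟ e
  ... | yes refl = ℕ.<⇒≱ (sparse R)
        (s≤s⁻¹ (ℕ.≤-trans (s≤s (k≤ refl))
                 (ℕ.≤-trans (ℕ.≤-reflexive (ℕ.+-comm 1 m))
                   (ℕ.≤-trans (ℕ.+-monoʳ-≤ m (1≤length T)) bound))))
  ... | no e₀≢e = ¬Sx (proj₁ (cross e₀≢e (trans (sym a≡x) a≡v)))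

  -- A short closed walk would either stay in one copy or cast a closed shadow of length at most
  -- `l`; this gain of one over `l` drives the girth induction.
  glue-sparse : NoClosedWalk≤ _~′_ (suc l)
  glue-sparse w = ℕ.≰⇒> λ n≤ → not-closed (state w n≤) n≤

-- Hypergraphs with a Ramsey property

Finite : Set → Set
Finite A = ∃[ n ] A ↔ Fin n

_⊎-finite_ : ∀ {A B} → Finite A → Finite B → Finite (A ⊎ B)
(_ , f) ⊎-finite (_ , g) = _ , ↔-trans (f ⊎-↔ g) (↔-sym +↔⊎)

_×-finite_ : ∀ {A B} → Finite A → Finite B → Finite (A × B)
(_ , f) ×-finite (_ , g) = _ , ↔-trans (f ×-↔ g) (↔-sym *↔×)

finite⇒≟ : ∀ {A} → Finite A → DecidableEquality A
finite⇒≟ (_ , f) = via-injection (↔⇒↣ f) Fin._≟_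

-- Strict growth of `rank` along edges lets a monotone map carry the coordinates of a box system
-- onto an edge; partite hypergraphs inherit it from `B` through `label`.
record Hypergraph (r : ℕ) : Set₁ where
  field
    {Vertex Edge} : Set
    {ranks}   : ℕ
    finV      : Finite Vertex
    finE      : Finite Edge
    _!_       : Edge → Fin r → Vertex
    rank      : Vertex → Fin ranks
    rank-mono : ∀ e {i j} → i Fin.< j → rank (e ! i) Fin.< rank (e ! j)

  _∈_ : REL Vertex Edge 0ℓ
  y ∈ e = ∃[ i ] e ! i ≡ y

  !-injective : ∀ e {i j} → e ! i ≡ e ! j → i ≡ j
  !-injective e {i} {j} eq with Fin.<-cmp i j
  ... | tri< i<j _ _ = contradiction (cong rank eq) (Fin.<⇒≢ (rank-mono e i<j))
  ... | tri≈ _ i≡j _ = i≡j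
  ... | tri> _ _ j<i = contradiction (cong rank (sym eq)) (Fin.<⇒≢ (rank-mono e j<i))

  Monochromatic : ∀ {c} → (Vertex → Fin c) → Edge → Set
  Monochromatic χ e = ∃[ κ ] ∀ i → χ (e ! i) ≡ κ

  Ramsey : ℕ → Set
  Ramsey c = (χ : Vertex → Fin c) → ∃[ e ] Monochromatic χ e

open Hypergraph using (Vertex; Edge; Monochromatic; Ramsey)

record OrderedRamsey (r c : ℕ) : Set₁ where
  field
    {size}  : ℕ
    {Edge′} : Set
    finE′   : Finite Edge′
    line    : Edge′ → Fin r → Fin size
    mono    : ∀ e {i j} → i Fin.< j → line e i Fin.< line e j
    ramsey  : (χ : Fin size → Fin c) → ∃[ e ] ∃[ κ ] ∀ i → χ (line e i) ≡ κ

-- r copies of the hypergraph for c colours, with every transversal added as an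
-- edge: either some copy misses colour zero, or that colour has a transversal.
orderedRamsey : ∀ r c → OrderedRamsey r c
orderedRamsey r zero = record
  { size = 1 ; finE′ = 0 , ↔-sym 0↔⊥ ; line = λ () ; mono = λ ()
  ; ramsey = λ χ → case χ Fin.zero of λ () }
orderedRamsey r (suc c) = record
  { finE′ = ((r , ↔-refl) ×-finite finE′) ⊎-finite (size ^ r , ↔-refl)
  ; line = line⁺ ; mono = mono⁺ ; ramsey = ramsey⁺ }
  where
  open OrderedRamsey (orderedRamsey r c)

  line⁺ : Fin r × Edge′ ⊎ Fin (size ^ r) → Fin r → Fin (r * size)
  line⁺ (inj₁ (k , e)) i = combine k (line e i)
  line⁺ (inj₂ f)       i = combine i (finToFun f i)

  mono⁺ : ∀ e {i j} → i Fin.< j → line⁺ e i Fin.< line⁺ e j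
  mono⁺ (inj₁ (k , e)) {i} {j} i<j =
    subst₂ _<_ (sym (toℕ-combine k (line e i))) (sym (toℕ-combine k (line e j)))
           (ℕ.+-monoʳ-< (size * toℕ k) (mono e i<j))
  mono⁺ (inj₂ f) i<j = combine-monoˡ-< _ _ i<j

  ramsey⁺ : (χ : Fin (r * size) → Fin (suc c)) → ∃[ e ] ∃[ κ ] ∀ i → χ (line⁺ e i) ≡ κ
  ramsey⁺ χ with all? (λ k → any? (λ y → χ (combine k y) Fin.≟ Fin.zero))
  ... | yes hit = inj₂ (funToFin (proj₁ ∘ hit)) , Fin.zero , λ k →
    trans (cong (χ ∘ combine k) (finToFun-funToFin (proj₁ ∘ hit) k)) (proj₂ (hit k))
  ... | no ¬hit with k , miss ← ¬∀⟶∃¬ r _ (λ k → any? (λ y → χ (combine k y) Fin.≟ Fin.zero)) ¬hit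
    with e , κ , same ← ramsey (λ y → punchOut (λ 0≡ → miss (y , sym 0≡))) =
    inj₁ (k , e) , Fin.suc κ , λ i →
      trans (sym (punchIn-punchOut {i = Fin.zero} (λ 0≡ → miss (line e i , sym 0≡)))) (cong Fin.suc (same i))

ramseyHypergraph : ∀ r c → Σ (Hypergraph r) λ B → Ramsey B c
ramseyHypergraph r c = record
  { finV = _ , ↔-refl ; finE = finE′ ; _!_ = line ; rank = λ i → i ; rank-mono = mono } , ramsey
  where open OrderedRamsey (orderedRamsey r c)

Sparse : ∀ {r} → Hypergraph r → ℕ → Set
Sparse H = NoClosedWalk≤ (Incidence (Hypergraph._∈_ H))

-- The partite construction

-- The partite construction: one makes the colouring constant on the parts of
-- a hypergraph over B one part at a time, by gluing copies of it along a
-- sparse hypergraph whose vertices replace that part. In Partite k this has been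
-- done for the first k parts.
module _ {r c l : ℕ} (B : Hypergraph r) (ramseyB : Ramsey B c)
         (sparseHypergraph : ∀ s → Σ (Hypergraph s) λ H → Ramsey H c × Sparse H l) where
  private
    module B = Hypergraph B
    open Inverse (proj₂ B.finV) using () renaming (to to number)

  record Partite (k : ℕ) : Set₁ where
    field
      P        : Hypergraph r
      label    : Vertex P → B.Vertex
      shape    : Edge P → B.Edge
      label-!  : ∀ f i → label (Hypergraph._!_ P f i) ≡ shape f B.! i
      sparse   : Sparse P (suc l)
      ramsey   : (χ : Vertex P → Fin c) →
                 (∀ y → k ≤ toℕ (number y) → ∃[ κ ] ∀ x → label x ≡ y → χ x ≡ κ) →
                 ∃[ f ] Monochromatic P χ f

  -- A colouring constant on all parts is a colouring of `B`, and a monochromatic edge of `B` has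
  -- its own copy here.
  disjointEdges : Partite 0
  disjointEdges = record
    { P = P ; label = label ; shape = λ f → f ; label-! = λ _ _ → refl
    ; sparse = λ w → ⊥-elim (acyclic w)
    ; ramsey = λ χ const →
        let τ = λ y → proj₁ (const y z≤n)
            f , κ , same = ramseyB τ
        in f , κ , λ i → trans (proj₂ (const (f B.! i) z≤n) (f , i) refl) (same i) }
    where
    label : B.Edge × Fin r → B.Vertex
    label (f , i) = f B.! i
    P : Hypergraph r
    P = record { finV = B.finE ×-finite (r , ↔-refl) ; finE = B.finE ; _!_ = _,_
               ; rank = B.rank ∘ label ; rank-mono = B.rank-mono }
    _⟷_ : Rel ((B.Edge × Fin r) ⊎ B.Edge) 0ℓ
    _⟷_ = Incidence (Hypergraph._∈_ P)
    leaf : ∀ {f x g} → inj₂ f ⟷ inj₁ x → inj₁ x ⟷ inj₂ g → g ≡ f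
    leaf (from (_ , refl)) (into (_ , refl)) = refl
    -- Any three consecutive steps pass through a vertex, which lies in one edge only and so forces
    -- a backtrack.
    acyclic : ∀ {a p n} → ¬ Walk _⟷_ a p a n
    acyclic (first ())
    acyclic (next (first _) _ a≢a) = a≢a refl
    acyclic (next {p} {inj₁ _} (next _ s@(from _) _) s′@(into _) r≢p) = r≢p (cong inj₂ (leaf s s′))
    acyclic (next (next (first s@(from _)) s′@(into _) r≢p) _ _) = r≢p (cong inj₂ (leaf s s′))
    acyclic (next (next (next _ s@(from _) _) s′@(into _) r≢p) _ _) = r≢p (cong inj₂ (leaf s s′))

  processPart : ∀ k → k < proj₁ B.finV → Partite k → Partite (suc k)
  processPart k k<m 𝒫 = record
    { P = P⁺ ; label = label⁺ ; shape = λ (_ , f) → shape f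
    ; label-! = λ (e , f) i → trans (label-ι e (f P.! i)) (label-! f i)
    ; sparse = glue-sparse gluing l sparseH sparse
    ; ramsey = ramsey⁺ }
    where
    open Partite 𝒫
    module P = Hypergraph P
    y₀ : B.Vertex
    y₀ = Inverse.from (proj₂ B.finV) (Fin.fromℕ< k<m)
    finNode : Finite (P.Vertex ⊎ P.Edge)
    finNode = P.finV ⊎-finite P.finE
    open Inverse (proj₂ finNode) using () renaming (to to index)
    -- Edges get a slot for every vertex and edge of `P`, which makes `h` total and injective
    -- without enumerating the part of `y₀`.
    ℋ = sparseHypergraph (proj₁ finNode)
    module H = Hypergraph (proj₁ ℋ)
    sparseH : Sparse (proj₁ ℋ) l
    sparseH = proj₂ (proj₂ ℋ)
    _≟B_ : DecidableEquality B.Vertex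
    _≟B_ = finite⇒≟ B.finV

    Vertex⁺ : Set
    Vertex⁺ = H.Vertex ⊎ (H.Edge × P.Vertex)

    place : ∀ {x} → H.Edge → Dec (label x ≡ y₀) → Vertex⁺
    place {x} e (yes _) = inj₁ (e H.! index (inj₁ x))
    place {x} e (no _)  = inj₂ (e , x)

    ι : H.Edge → P.Vertex → Vertex⁺
    ι e x = place e (label x ≟B y₀)

    label⁺ : Vertex⁺ → B.Vertex
    label⁺ (inj₁ _)       = y₀
    label⁺ (inj₂ (_ , x)) = label x

    label-ι : ∀ e x → label⁺ (ι e x) ≡ label x
    label-ι e x with label x ≟B y₀
    ... | yes eq = sym eq
    ... | no _   = refl

    index-injective : ∀ {u v} → index u ≡ index v → u ≡ v
    index-injective = Injection.injective (↔⇒↣ (proj₂ finNode))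

    ι-injective : ∀ {e x y} → ι e x ≡ ι e y → x ≡ y
    ι-injective {e} {x} {y} eq with label x ≟B y₀ | label y ≟B y₀
    ... | yes _ | yes _ = inj₁-injective (index-injective (H.!-injective e (inj₁-injective eq)))
    ... | no _  | no _  = cong proj₂ (inj₂-injective eq)

    ι-cross : ∀ {e f x y} → e ≢ f → ι e x ≡ ι f y →
              label x ≡ y₀ × label y ≡ y₀ × e H.! index (inj₁ x) ≡ f H.! index (inj₁ y)
    ι-cross {x = x} {y} e≢f eq with label x ≟B y₀ | label y ≟B y₀
    ... | yes lx | yes ly = lx , ly , inj₁-injective eq
    ... | no _   | no _   = contradiction (cong proj₁ (inj₂-injective eq)) e≢f

    P⁺ : Hypergraph r
    P⁺ = record
      { finV = H.finV ⊎-finite (H.finE ×-finite P.finV)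
      ; finE = H.finE ×-finite P.finE
      ; _!_ = λ (e , f) i → ι e (f P.! i)
      ; rank = B.rank ∘ label⁺
      ; rank-mono = λ (e , f) {i} {j} i<j →
          subst₂ Fin._<_ (cong B.rank (sym (trans (label-ι e (f P.! i)) (label-! f i))))
                     (cong B.rank (sym (trans (label-ι e (f P.! j)) (label-! f j))))
                     (B.rank-mono (shape f) i<j) }

    -- A monochromatic edge `e` of the gluing hypergraph makes the part of `y₀` constant on copy
    -- `e`, where the property of `P` then applies.
    ramsey⁺ : (χ : Vertex⁺ → Fin c) →
              (∀ y → suc k ≤ toℕ (number y) → ∃[ κ ] ∀ x → label⁺ x ≡ y → χ x ≡ κ) →
              ∃[ f ] Monochromatic P⁺ χ f
    ramsey⁺ χ const =
      let e , κ , same = proj₁ (proj₂ ℋ) (χ ∘ inj₁)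
          f , mono     = ramsey (χ ∘ ι e) (const⁻ e κ same)
      in (e , f) , mono
      where
      const⁻ : ∀ e κ → (∀ i → χ (inj₁ (e H.! i)) ≡ κ) →
               ∀ y → k ≤ toℕ (number y) → ∃[ κ ] ∀ x → label x ≡ y → χ (ι e x) ≡ κ
      const⁻ e κ same y k≤ with y ≟B y₀
      ... | yes refl = κ , on-part
        where
        on-part : ∀ x → label x ≡ y₀ → χ (ι e x) ≡ κ
        on-part x lx with label x ≟B y₀
        ... | yes _  = same (index (inj₁ x))
        ... | no lx≢ = contradiction lx lx≢
      ... | no y≢ =
        let κ′ , same′ = const y (ℕ.≤∧≢⇒< k≤ k≢)
        in κ′ , λ x lx → same′ (ι e x) (trans (label-ι e x) lx)
        where
        k≢ : k ≢ toℕ (number y)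
        k≢ eq = y≢ (trans (sym (Inverse.strictlyInverseʳ (proj₂ B.finV) y))
                   (cong (Inverse.from (proj₂ B.finV))
                         (toℕ-injective (trans (sym eq) (sym (toℕ-fromℕ< k<m))))))

    -- Copies meet only in the part of `y₀`. Two vertices of that part on a common edge coincide,
    -- because `label` is injective on each edge; this gives `S-far`.
    gluing : Gluing (Incidence P._∈_) (Incidence (Hypergraph._∈_ P⁺)) H._∈_
    gluing = record
      { S = S ; S? = S? ; _≟_ = finite⇒≟ H.finE ; ι = ι̂ ; h = h
      ; ι-inj = ι̂-injective
      ; h-inj = λ {e} _ _ eq → index-injective (H.!-injective e eq)
      ; edge = edge
      ; h-∈ = λ _ → _ , refl
      ; cross = cross
      ; S-apart = λ { {inj₁ _} {inj₁ _} _ _ () }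
      ; S-far = λ { {inj₁ _} {inj₁ _} lx ly (into (i , refl)) (from {e = f} (j , refl)) →
                      cong (λ i → inj₁ (f P.! i)) (B.!-injective (shape f)
                        (trans (trans (sym (label-! f i)) (trans lx (sym ly))) (label-! f j))) } }
      where
      S : Pred (P.Vertex ⊎ P.Edge) 0ℓ
      S (inj₁ x) = label x ≡ y₀
      S (inj₂ _) = ⊥
      S? : Decidable S
      S? (inj₁ x) = label x ≟B y₀
      S? (inj₂ _) = no λ ()
      ι̂ : H.Edge → P.Vertex ⊎ P.Edge → Vertex⁺ ⊎ (H.Edge × P.Edge)
      ι̂ e (inj₁ x) = inj₁ (ι e x)
      ι̂ e (inj₂ f) = inj₂ (e , f)
      h : H.Edge → P.Vertex ⊎ P.Edge → H.Vertex
      h e u = e H.! index u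
      ι̂-injective : ∀ {e u v} → ι̂ e u ≡ ι̂ e v → u ≡ v
      ι̂-injective {u = inj₁ _} {inj₁ _} eq = cong inj₁ (ι-injective (inj₁-injective eq))
      ι̂-injective {u = inj₂ _} {inj₂ _} eq = cong (inj₂ ∘ proj₂) (inj₂-injective eq)
      edge : ∀ {p q} → Incidence (Hypergraph._∈_ P⁺) p q →
             ∃[ e ] ∃[ u ] ∃[ v ] (p ≡ ι̂ e u × q ≡ ι̂ e v × Incidence P._∈_ u v)
      edge (into {e = (e , f)} (i , refl)) = e , inj₁ (f P.! i) , inj₂ f , refl , refl , into (i , refl)
      edge (from {e = (e , f)} (i , refl)) = e , inj₂ f , inj₁ (f P.! i) , refl , refl , from (i , refl)
      cross : ∀ {e f u v} → e ≢ f → ι̂ e u ≡ ι̂ f v → S u × S v × h e u ≡ h f v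
      cross {u = inj₁ _} {inj₁ _} e≢f eq = ι-cross e≢f (inj₁-injective eq)
      cross {u = inj₂ _} {inj₂ _} e≢f eq = contradiction (cong proj₁ (inj₂-injective eq)) e≢f

  processParts : ∀ k → k ≤ proj₁ B.finV → Partite k
  processParts zero    _   = disjointEdges
  processParts (suc k) k<m = processPart k k<m (processParts k (ℕ.<⇒≤ k<m))

  -- Once all parts are processed, the constancy hypothesis is vacuous.
  increaseGirth : Σ (Hypergraph r) λ H → Ramsey H c × Sparse H (suc l)
  increaseGirth = P , (λ χ → ramsey χ λ y m≤ → contradiction (toℕ<n (number y)) (ℕ.≤⇒≯ m≤)) , sparse
    where open Partite (processParts _ ℕ.≤-refl)

-- Induction on `l` for all `r` at once, since a step at uniformity `r` glues along hypergraphs with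
-- other edge sizes.
sparseHypergraph : ∀ l r c → Σ (Hypergraph r) λ H → Ramsey H c × Sparse H l
sparseHypergraph zero r c with B , ramsey ← ramseyHypergraph r c = B , ramsey , λ where
  (first _)    → s≤s z≤n
  (next _ _ _) → s≤s z≤n
sparseHypergraph (suc l) r c with B , ramsey ← ramseyHypergraph r c =
  increaseGirth B ramsey λ s → sparseHypergraph l s c

-- Box systems and pendant leaves

combine-mono-≤ : ∀ {m n} {i j : Fin m} {k l : Fin n} →
                 i Fin.≤ j → k Fin.≤ l → combine i k Fin.≤ combine j l
combine-mono-≤ {n = n} {i} {j} {k} {l} i≤j k≤l =
  subst₂ _≤_ (sym (toℕ-combine i k)) (sym (toℕ-combine j l)) (ℕ.+-mono-≤ (ℕ.*-monoʳ-≤ n i≤j) k≤l)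

combine-cancelˡ-≤ : ∀ {m n} {i j : Fin m} (k l : Fin n) → combine i k Fin.≤ combine j l → i Fin.≤ j
combine-cancelˡ-≤ k l ≤ = ℕ.≮⇒≥ λ j<i → ℕ.<⇒≱ (combine-monoˡ-< l k j<i) ≤

combine-cancelʳ-≤ : ∀ {m n} (i : Fin m) {k l : Fin n} → combine i k Fin.≤ combine i l → k Fin.≤ l
combine-cancelʳ-≤ {n = n} i {k} {l} ≤ =
  ℕ.+-cancelˡ-≤ (n * toℕ i) _ _ (subst₂ _≤_ (toℕ-combine i k) (toℕ-combine i l) ≤)

-- Projected to the first and third coordinates, the box of v is
-- [left v , key v] × [key v , right v]: its corner (key v , key v) is its only
-- point on the diagonal.
record BoxSystem : Set₁ where
  field
    {V}      : Set
    {K D}    : ℕ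
    finV     : Finite V
    left key right : V → Fin K
    low high : V → Fin D
    left≤key  : ∀ v → left v Fin.≤ key v
    key≤right : ∀ v → key v Fin.≤ right v
    low≤high  : ∀ v → low v Fin.≤ high v
    key-injective : ∀ {v w} → key v ≡ key w → v ≡ w

  lo hi : V → Fin 3 → ℕ
  lo v 0F = toℕ (left v)
  lo v 1F = toℕ (low v)
  lo v 2F = toℕ (key v)
  hi v 0F = toℕ (key v)
  hi v 1F = toℕ (high v)
  hi v 2F = toℕ (right v)

  _~_ : Rel V 0ℓ
  v ~ w = v ≢ w × ∀ i → lo v i ≤ hi w i × lo w i ≤ hi v i

  Uncolourable : ℕ → Set
  Uncolourable c = (χ : V → Fin c) → ¬ (∀ {v w} → v ~ w → χ v ≢ χ w)

-- A leaf at each vertex stands for the line that its box will touch. Distinct leaves are at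
-- distance at least three, as gluing requires.
data Pendant {V : Set} (_~_ : Rel V 0ℓ) : Rel (V ⊎ V) 0ℓ where
  core : ∀ {v w} → v ~ w → Pendant _~_ (inj₁ v) (inj₁ w)
  up   : ∀ {v} → Pendant _~_ (inj₁ v) (inj₂ v)
  down : ∀ {v} → Pendant _~_ (inj₂ v) (inj₁ v)

module _ {V : Set} {_~_ : Rel V 0ℓ} where
  ¬up-down : ∀ {a p v n} → Walk (Pendant _~_) a p (inj₂ v) n → ¬ inj₁ v ≢ p
  ¬up-down (first up)    v≢p = v≢p refl
  ¬up-down (next _ up _) v≢p = v≢p refl

  coreWalk : ∀ {a p q n} → Walk (Pendant _~_) (inj₁ a) p (inj₁ q) n →
             ∃[ p′ ] (p ≡ inj₁ p′ × Walk _~_ a p′ q n)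
  coreWalk (first (core a~q)) = _ , refl , first a~q
  coreWalk (next w down v≢p) = contradiction v≢p (¬up-down w)
  coreWalk (next w (core q~r) r≢p) with _ , refl , w′ ← coreWalk w =
    _ , refl , next w′ q~r (r≢p ∘ cong inj₁)

  pendantWalk : ∀ {a p q n} → Walk (Pendant _~_) (inj₂ a) p (inj₁ q) n →
                (p ≡ inj₂ a × q ≡ a) ⊎
                ∃[ p′ ] ∃[ m ] (p ≡ inj₁ p′ × m < n × Walk _~_ a p′ q m)
  pendantWalk (first down) = inj₁ (refl , refl)
  pendantWalk (next w down v≢p) = contradiction v≢p (¬up-down w)
  pendantWalk (next w (core q~r) r≢p) with pendantWalk w
  ... | inj₁ (refl , refl) = inj₂ (_ , _ , refl , s≤s (1≤length w) , first q~r)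
  ... | inj₂ (_ , m , refl , m<n , w′) = inj₂ (_ , _ , refl , s≤s m<n , next w′ q~r (r≢p ∘ cong inj₁))

  -- A leaf has one neighbour, so a reduced walk visits leaves only at its ends; trimming them
  -- leaves a closed walk in the core.
  pendant-sparse : ∀ {l} → NoClosedWalk≤ _~_ l → NoClosedWalk≤ (Pendant _~_) l
  pendant-sparse sparse {inj₁ a} w with _ , refl , w′ ← coreWalk w = sparse w′
  pendant-sparse sparse {inj₂ a} (next w up a≢p) with pendantWalk w
  ... | inj₁ (refl , _) = contradiction refl a≢p
  ... | inj₂ (_ , _ , _ , m<n , w′) = ℕ.m<n⇒m<1+n (ℕ.<-trans (sparse w′) m<n)

-- Hanging box systems on a hypergraph

-- Outer coordinates are pairs: a position on the diagonal, and a component that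
-- only serves to give different keys to boxes touching the same line.
module _ (𝒲 : BoxSystem) (H : Hypergraph (BoxSystem.K 𝒲)) where
  private
    module W = BoxSystem 𝒲
    module H = Hypergraph H
    open Inverse (proj₂ H.finV) using () renaming (to to vertexIndex)
    open Inverse (proj₂ H.finE) using () renaming (to to edgeIndex)

    #E : ℕ
    #E = proj₁ H.finE

    -- The rank comes first so that positions increase along edges; the index separates vertices of
    -- equal rank.
    pos : H.Vertex → Fin (H.ranks * proj₁ H.finV)
    pos y = combine (H.rank y) (vertexIndex y)

    pos-injective : ∀ {x y} → pos x ≡ pos y → x ≡ y
    pos-injective {x} {y} eq =
      Injection.injective (↔⇒↣ (proj₂ H.finV)) (combine-injectiveʳ (H.rank x) _ (H.rank y) _ eq)

    φ : H.Edge → Fin W.K → Fin (H.ranks * proj₁ H.finV)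
    φ e t = pos (e H.! t)

    φ-mono-< : ∀ e {s t} → s Fin.< t → φ e s Fin.< φ e t
    φ-mono-< e s<t = combine-monoˡ-< _ _ (H.rank-mono e s<t)

    φ-mono-≤ : ∀ e {s t} → s Fin.≤ t → φ e s Fin.≤ φ e t
    φ-mono-≤ e {s} {t} s≤t with Fin.<-cmp s t
    ... | tri< s<t _ _  = ℕ.<⇒≤ (φ-mono-< e s<t)
    ... | tri≈ _ refl _ = ℕ.≤-refl
    ... | tri> _ _ t<s  = contradiction s≤t (ℕ.<⇒≱ t<s)

    φ-cancel-≤ : ∀ e {s t} → φ e s Fin.≤ φ e t → s Fin.≤ t
    φ-cancel-≤ e φ≤ = ℕ.≮⇒≥ λ t<s → ℕ.<⇒≱ (φ-mono-< e t<s) φ≤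

  -- Second components are least in `left` and greatest in `right`, so overlaps depend on positions
  -- alone. In the middle coordinate a line spans everything and copy `e` has its own block.
  hang : BoxSystem
  hang = record
    { finV = H.finV ⊎-finite (H.finE ×-finite W.finV)
    ; left  = λ { (inj₁ y) → combine (pos y) Fin.zero
                ; (inj₂ (e , v)) → combine (φ e (W.left v)) Fin.zero }
    ; key   = key
    ; right = λ { (inj₁ y) → combine (pos y) (Fin.fromℕ #E)
                ; (inj₂ (e , v)) → combine (φ e (W.right v)) (Fin.fromℕ #E) }
    ; low   = λ { (inj₁ y) → Fin.zero
                ; (inj₂ (e , v)) → Fin.suc (combine (edgeIndex e) (W.low v)) }
    ; high  = λ { (inj₁ y) → Fin.fromℕ (#E * W.D)
                ; (inj₂ (e , v)) → Fin.suc (combine (edgeIndex e) (W.high v)) }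
    ; left≤key = λ { (inj₁ y) → ℕ.≤-refl
                   ; (inj₂ (e , v)) → combine-mono-≤ (φ-mono-≤ e (W.left≤key v)) z≤n }
    ; key≤right = λ { (inj₁ y) → combine-mono-≤ {i = pos y} ℕ.≤-refl z≤n
                    ; (inj₂ (e , v)) → combine-mono-≤ (φ-mono-≤ e (W.key≤right v)) (≤fromℕ _) }
    ; low≤high = λ { (inj₁ y) → z≤n
                   ; (inj₂ (e , v)) → s≤s (combine-mono-≤ {i = edgeIndex e} ℕ.≤-refl (W.low≤high v)) }
    ; key-injective = key-injective }
    where
    key : H.Vertex ⊎ (H.Edge × W.V) → Fin ((H.ranks * proj₁ H.finV) * suc #E)
    key (inj₁ y)       = combine (pos y) Fin.zero
    key (inj₂ (e , v)) = combine (φ e (W.key v)) (Fin.suc (edgeIndex e))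
    key-injective : ∀ {v w} → key v ≡ key w → v ≡ w
    key-injective {inj₁ x} {inj₁ y} eq = cong inj₁ (pos-injective (combine-injectiveˡ (pos x) _ (pos y) _ eq))
    key-injective {inj₁ x} {inj₂ (f , w)} eq with () ← combine-injectiveʳ (pos x) _ (φ f (W.key w)) _ eq
    key-injective {inj₂ (e , v)} {inj₁ y} eq with () ← combine-injectiveʳ (φ e (W.key v)) _ (pos y) _ eq
    key-injective {inj₂ (e , v)} {inj₂ (f , w)} eq
      with p≡ , s≡ ← combine-injective (φ e (W.key v)) _ (φ f (W.key w)) _ eq
      with refl ← Injection.injective (↔⇒↣ (proj₂ H.finE)) (Fin.suc-injective s≡) =
      cong (λ v → inj₂ (e , v)) (W.key-injective (H.!-injective e (pos-injective p≡)))

  private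
    module W⁺ = BoxSystem hang

    copy-adj : ∀ {e v w} → v W.~ w → inj₂ (e , v) W⁺.~ inj₂ (e , w)
    copy-adj {e} {v} {w} (v≢w , o) = v≢w ∘ cong proj₂ ∘ inj₂-injective , λ where
      0F → combine-mono-≤ (φ-mono-≤ e (proj₁ (o 0F))) z≤n , combine-mono-≤ (φ-mono-≤ e (proj₂ (o 0F))) z≤n
      1F → s≤s (combine-mono-≤ {i = edgeIndex e} ℕ.≤-refl (proj₁ (o 1F))) ,
           s≤s (combine-mono-≤ {i = edgeIndex e} ℕ.≤-refl (proj₂ (o 1F)))
      2F → combine-mono-≤ (φ-mono-≤ e (proj₁ (o 2F))) (≤fromℕ _) ,
           combine-mono-≤ (φ-mono-≤ e (proj₂ (o 2F))) (≤fromℕ _)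

    line-adj : ∀ e v → inj₁ (e H.! W.key v) W⁺.~ inj₂ (e , v)
    line-adj e v = (λ ()) , λ where
      0F → combine-mono-≤ {i = φ e (W.key v)} ℕ.≤-refl z≤n , combine-mono-≤ (φ-mono-≤ e (W.left≤key v)) z≤n
      1F → z≤n , ≤fromℕ _
      2F → combine-mono-≤ (φ-mono-≤ e (W.key≤right v)) z≤n , combine-mono-≤ {i = φ e (W.key v)} ℕ.≤-refl (≤fromℕ _)

    lines-apart : ∀ {x y} → ¬ inj₁ x W⁺.~ inj₁ y
    lines-apart {x} {y} (x≢y , o) = x≢y (cong inj₁ (pos-injective (Fin.≤-antisym
      (combine-cancelˡ-≤ Fin.zero Fin.zero (proj₁ (o 0F))) (combine-cancelˡ-≤ Fin.zero Fin.zero (proj₂ (o 0F))))))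

    -- The first coordinate bounds the position of `y` from above by that of the corner, the third
    -- from below.
    on-line : ∀ {y e v} → (∀ i → W⁺.lo (inj₁ y) i ≤ W⁺.hi (inj₂ (e , v)) i ×
                                 W⁺.lo (inj₂ (e , v)) i ≤ W⁺.hi (inj₁ y) i) →
              y ≡ e H.! W.key v
    on-line {y} {e} {v} o = pos-injective (Fin.≤-antisym
      (combine-cancelˡ-≤ Fin.zero (Fin.suc (edgeIndex e)) (proj₁ (o 0F)))
      (combine-cancelˡ-≤ (Fin.suc (edgeIndex e)) (Fin.fromℕ #E) (proj₂ (o 2F))))

    same-layer : ∀ {e f v w} → inj₂ (e , v) W⁺.~ inj₂ (f , w) → e ≡ f
    same-layer {e} {f} {v} {w} (_ , o) = Injection.injective (↔⇒↣ (proj₂ H.finE)) (Fin.≤-antisym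
      (combine-cancelˡ-≤ (W.low v) (W.high w) (s≤s⁻¹ (proj₁ (o 1F))))
      (combine-cancelˡ-≤ (W.low w) (W.high v) (s≤s⁻¹ (proj₂ (o 1F)))))

    copy-adj⁻¹ : ∀ {e v w} → inj₂ (e , v) W⁺.~ inj₂ (e , w) → v W.~ w
    copy-adj⁻¹ {e} {v} {w} (v≢w , o) = v≢w ∘ cong (λ v → inj₂ (e , v)) , λ where
      0F → φ-cancel-≤ e (combine-cancelˡ-≤ _ _ (proj₁ (o 0F))) , φ-cancel-≤ e (combine-cancelˡ-≤ _ _ (proj₂ (o 0F)))
      1F → combine-cancelʳ-≤ (edgeIndex e) (s≤s⁻¹ (proj₁ (o 1F))) ,
           combine-cancelʳ-≤ (edgeIndex e) (s≤s⁻¹ (proj₂ (o 1F)))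
      2F → φ-cancel-≤ e (combine-cancelˡ-≤ _ _ (proj₁ (o 2F))) , φ-cancel-≤ e (combine-cancelˡ-≤ _ _ (proj₂ (o 2F)))

    pendants : Gluing (Pendant W._~_) W⁺._~_ H._∈_
    pendants = record
      { S = S ; S? = S? ; _≟_ = finite⇒≟ H.finE ; ι = ι ; h = h
      ; ι-inj = ι-inj
      ; h-inj = λ { {e} {inj₂ _} {inj₂ _} _ _ eq → cong inj₂ (W.key-injective (H.!-injective e eq)) }
      ; edge = edge _ _
      ; h-∈ = λ _ → _ , refl
      ; cross = cross
      ; S-apart = λ { {inj₂ _} {inj₂ _} _ _ () }
      ; S-far = λ { {inj₂ _} {inj₂ _} _ _ down up → refl } }
      where
      S : Pred (W.V ⊎ W.V) 0ℓ
      S (inj₁ _) = ⊥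
      S (inj₂ _) = ⊤
      S? : Decidable S
      S? (inj₁ _) = no λ ()
      S? (inj₂ _) = yes tt
      h : H.Edge → W.V ⊎ W.V → H.Vertex
      h e u = e H.! W.key (reduce u)
      ι : H.Edge → W.V ⊎ W.V → W⁺.V
      ι e (inj₁ v) = inj₂ (e , v)
      ι e (inj₂ v) = inj₁ (e H.! W.key v)
      ι-inj : ∀ {e u v} → ι e u ≡ ι e v → u ≡ v
      ι-inj {u = inj₁ _} {inj₁ _} refl = refl
      ι-inj {e} {inj₂ _} {inj₂ _} eq = cong inj₂ (W.key-injective (H.!-injective e (inj₁-injective eq)))
      cross : ∀ {e f u v} → e ≢ f → ι e u ≡ ι f v → S u × S v × h e u ≡ h f v
      cross {u = inj₁ _} {inj₁ _} e≢f refl = contradiction refl e≢f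
      cross {u = inj₂ _} {inj₂ _} e≢f eq = tt , tt , inj₁-injective eq
      edge : ∀ p q → p W⁺.~ q → ∃[ e ] ∃[ u ] ∃[ v ] (p ≡ ι e u × q ≡ ι e v × Pendant W._~_ u v)
      edge (inj₁ x) (inj₁ y) p~q = contradiction p~q lines-apart
      edge (inj₁ y) (inj₂ (e , v)) p~q =
        e , inj₂ v , inj₁ v , cong inj₁ (on-line (proj₂ p~q)) , refl , down
      edge (inj₂ (e , v)) (inj₁ y) (_ , o) =
        e , inj₁ v , inj₂ v , refl , cong inj₁ (on-line (λ i → swap (o i))) , up
      edge (inj₂ (e , v)) (inj₂ (f , w)) p~q with refl ← same-layer p~q =
        e , inj₁ v , inj₁ w , refl , refl , core (copy-adj⁻¹ p~q)

  hang-sparse : ∀ {l} → NoClosedWalk≤ W._~_ (suc l) → Sparse H l → NoClosedWalk≤ W⁺._~_ (suc l)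
  hang-sparse sparse sparseH = glue-sparse pendants _ sparseH (pendant-sparse sparse)

  -- Each box of copy `e` meets a line of colour `κ`, so the copy avoids `κ` and would need only `c`
  -- colours.
  hang-uncolourable : ∀ {c} → W.Uncolourable c → Ramsey H (suc c) → W⁺.Uncolourable (suc c)
  hang-uncolourable uncol ramsey χ proper with e , κ , same ← ramsey (χ ∘ inj₁) =
    uncol (λ v → punchOut (κ≢ v)) λ v~w eq →
      proper (copy-adj v~w) (punchOut-injective (κ≢ _) (κ≢ _) eq)
    where
    κ≢ : ∀ v → κ ≢ χ (inj₂ (e , v))
    κ≢ v eq = proper (line-adj e v) (trans (same (W.key v)) eq)

boxSystem : ∀ l c → Σ BoxSystem λ 𝒲 → BoxSystem.Uncolourable 𝒲 c × NoClosedWalk≤ (BoxSystem._~_ 𝒲) (suc l)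
boxSystem l zero = record
  { finV = 1 , ↔-refl ; left = id ; key = id ; right = id ; low = id ; high = id
  ; left≤key = λ _ → ℕ.≤-refl ; key≤right = λ _ → ℕ.≤-refl ; low≤high = λ _ → ℕ.≤-refl
  ; key-injective = id }
  , (λ χ _ → case χ 0F of λ ())
  , λ w → contradiction w edgeless
  where
  edgeless : ∀ {_~_ : Rel (Fin 1) 0ℓ} {a p n} → ¬ Walk (λ v w → v ≢ w × v ~ w) a p a n
  edgeless (first (a≢a , _)) = a≢a refl
  edgeless (next {q = 0F} {0F} _ (q≢r , _) _) = q≢r refl
boxSystem l (suc c) =
  let 𝒲 , uncol , sparse   = boxSystem l c
      -- One slot per outer coordinate value, so that `φ` can place all of them on an edge.
      H , ramsey , sparseH = sparseHypergraph l (BoxSystem.K 𝒲) (suc c)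
  in hang 𝒲 H , hang-uncolourable 𝒲 H uncol ramsey , hang-sparse 𝒲 H sparse sparseH

-- Realisation by boxes

fromℤ-mono-≤ : ∀ {m n} → m ≤ n → fromℤ (+ m) ℚ.≤ fromℤ (+ n)
fromℤ-mono-≤ m≤n = *≤* (subst₂ ℤ._≤_ (sym (ℤ.*-identityʳ _)) (sym (ℤ.*-identityʳ _)) (+≤+ m≤n))

fromℤ-mono-< : ∀ {m n} → m < n → fromℤ (+ m) ℚ.< fromℤ (+ n)
fromℤ-mono-< m<n = *<* (subst₂ ℤ._<_ (sym (ℤ.*-identityʳ _)) (sym (ℤ.*-identityʳ _)) (+<+ m<n))

real : ℕ → ℝ
real n = record
  { L = ℚ._< fromℤ (+ n) ; U = fromℤ (+ n) ℚ.<_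
  ; L-inhabited = fromℤ -[1+ 0 ] , *<* (subst (ℤ._<_ -[1+ 0 ]) (sym (ℤ.*-identityʳ (+ n))) -<+)
  ; U-inhabited = fromℤ (+ suc n) , fromℤ-mono-< ℕ.≤-refl
  ; L-lower = ℚ.<-trans ; U-upper = λ q<r n<q → ℚ.<-trans n<q q<r
  ; L-open = λ q<n → let r , q<r , r<n = ℚ.<-dense q<n in r , q<r , r<n
  ; U-open = λ n<r → let q , n<q , q<r = ℚ.<-dense n<r in q , q<r , n<q
  ; disjoint = ℚ.<-asym
  ; located = located }
  where
  located : ∀ {q r} → q ℚ.< r → q ℚ.< fromℤ (+ n) ⊎ fromℤ (+ n) ℚ.< r
  located {q} q<r with q ℚ.<? fromℤ (+ n)
  ... | yes q<n = inj₁ q<n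
  ... | no q≮n  = inj₂ (ℚ.≤-<-trans (ℚ.≮⇒≥ q≮n) q<r)

real-mono : ∀ {m n} → m ≤ n → real m ≤ᴿ real n
real-mono m≤n q<m = ℚ.<-≤-trans q<m (fromℤ-mono-≤ m≤n)

real-cancel : ∀ {m n} → real m ≤ᴿ real n → m ≤ n
real-cancel m≤n = ℕ.≮⇒≥ λ n<m → ℚ.<-irrefl refl (m≤n (fromℤ-mono-< n<m))

-- A cycle has at least three vertices, so those two steps apart are distinct and the walk around it
-- is reduced.
cycle⇒walk : ∀ {V : Set} {ℓ} (G : SimpleGraph V ℓ) {W : Set} {_~_ : Rel W 0ℓ} (f : V → W) →
             Injective _≡_ _≡_ f → (∀ {x y} → SimpleGraph.Adj G x y → f x ~ f y) →
             (C : Cycle G) → ∃[ a ] ∃[ p ] Walk _~_ a p a (Cycle.length C)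
cycle⇒walk G {_~_ = _~_} f f-inj hom
  record { m = suc (suc m) ; vertex = x ; injective = x-inj ; step = step ; close = close } =
  _ , _ , subst (Walk _~_ _ _ _) (cong (λ m → suc (suc (suc m))) (toℕ-fromℕ m))
    (next (<-weakInduction Prefix (first (hom (step 0F))) extend (Fin.fromℕ (suc m)))
          (hom close) (distinct λ ()))
  where
  distinct : ∀ {i j} → i ≢ j → f (x i) ≢ f (x j)
  distinct i≢j = i≢j ∘ x-inj ∘ f-inj
  Prefix : Fin (suc (suc m)) → Set
  Prefix j = Walk _~_ (f (x 0F)) (f (x (Fin.inject₁ j))) (f (x (Fin.suc j))) (suc (toℕ j))
  extend : ∀ j → Prefix (Fin.inject₁ j) → Prefix (Fin.suc j)
  extend j w = subst
    (λ n → Walk _~_ (f (x 0F)) (f (x (Fin.inject₁ (Fin.suc j)))) (f (x (Fin.suc (Fin.suc j)))) (2 + n))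
    (toℕ-inject₁ j)
    (next w (hom (step (Fin.suc j))) (distinct (far j)))
    where
    far : ∀ {n} (j : Fin n) → Fin.suc (Fin.suc j) ≢ Fin.inject₁ (Fin.inject₁ j)
    far (Fin.suc j) eq = far j (Fin.suc-injective eq)
cycle⇒walk G f f-inj hom record { m = 0 ; 3≤length = s≤s () }
cycle⇒walk G f f-inj hom record { m = 1 ; 3≤length = s≤s (s≤s ()) }

module _ (𝒲 : BoxSystem) where
  open BoxSystem 𝒲
  open Inverse (proj₂ finV) using (to; strictlyInverseʳ) renaming (from to vertex)

  vertex-injective : Injective _≡_ _≡_ vertex
  vertex-injective = Injection.injective (↔⇒↣ (↔-sym (proj₂ finV)))

  lo≤hi : ∀ v i → lo v i ≤ hi v i
  lo≤hi v 0F = left≤key v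
  lo≤hi v 1F = low≤high v
  lo≤hi v 2F = key≤right v

  toBox : V → Box
  toBox v = record { lower = real ∘ lo v ; upper = real ∘ hi v ; lower≤upper = real-mono ∘ lo≤hi v }

  -- The corner of v is its point with the largest first coordinate.
  ⊆⇒key≤ : ∀ v w → (∀ {x} → ⟦ toBox v ⟧ x → ⟦ toBox w ⟧ x) → key v Fin.≤ key w
  ⊆⇒key≤ v w v⊆w = real-cancel (proj₂ (v⊆w {real ∘ hi v} (λ i → real-mono (lo≤hi v i) , λ z → z) 0F))

  boxCollection : BoxCollection
  boxCollection = record
    { size = proj₁ finV ; box = toBox ∘ vertex
    ; distinct = λ {i} {j} (⊆ , ⊇) → vertex-injective (key-injective
        (Fin.≤-antisym (⊆⇒key≤ (vertex i) (vertex j) (λ {x} → ⊆ {x}))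
                       (⊆⇒key≤ (vertex j) (vertex i) (λ {x} → ⊇ {x})))) }

  open SimpleGraph (boxGraph boxCollection) using (Adj)

  Adj⇒~ : ∀ {i j} → Adj i j → vertex i ~ vertex j
  Adj⇒~ {i} {j} (i≢j , x , x∈i , x∈j) = i≢j ∘ vertex-injective , λ k →
    real-cancel {lo (vertex i) k} {hi (vertex j) k} (proj₂ (x∈j k) ∘ proj₁ (x∈i k)) ,
    real-cancel {lo (vertex j) k} {hi (vertex i) k} (proj₂ (x∈i k) ∘ proj₁ (x∈j k))

  ~⇒Adj : ∀ {i j} → vertex i ~ vertex j → Adj i j
  -- The coordinatewise maximum of the two lower corners lies in both boxes.
  ~⇒Adj {i} {j} (v≢w , o) = v≢w ∘ cong vertex , (λ k → real (lo (vertex i) k ⊔ lo (vertex j) k)) ,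
    (λ k → real-mono (ℕ.m≤m⊔n _ _) , real-mono (ℕ.⊔-lub (lo≤hi (vertex i) k) (proj₂ (o k)))) ,
    (λ k → real-mono (ℕ.m≤n⊔m (lo (vertex i) k) _) , real-mono (ℕ.⊔-lub (proj₁ (o k)) (lo≤hi (vertex j) k)))

  girth : ∀ {l} → NoClosedWalk≤ _~_ l → Girth≥ (boxGraph boxCollection) (suc l)
  girth sparse C with _ , _ , w ← cycle⇒walk (boxGraph boxCollection) vertex vertex-injective Adj⇒~ C = sparse w

  chromatic : ∀ {k} → Uncolourable k → ChromaticNumber≥ (boxGraph boxCollection) (suc k)
  chromatic uncol c record { colour = colour ; proper = proper } = ℕ.≰⇒> λ c≤k →
    uncol (λ v → Fin.inject≤ (colour (to v)) c≤k) λ {v} {w} v~w eq →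
      proper (~⇒Adj (subst₂ _~_ (sym (strictlyInverseʳ v)) (sym (strictlyInverseʳ w)) v~w))
             (inject≤-injective c≤k c≤k (colour (to v)) (colour (to w)) eq)

theorem1 : (g k : ℕ) → 3 ≤ g → 1 ≤ k →
    ∃[ 𝓑 ] (Girth≥ (boxGraph 𝓑) g × ChromaticNumber≥ (boxGraph 𝓑) k)
theorem1 (suc (suc l)) (suc c) _ _ =
  -- Here `g` is `suc (suc l)` and `k` is `suc c`: closed walks longer than `suc l` have length at
  -- least `g`, and failing with `c` colours forces `k`.
  let 𝒲 , uncol , sparse = boxSystem l c
  in boxCollection 𝒲 , girth 𝒲 sparse , chromatic 𝒲 uncol
theorem1 1 _ (s≤s ()) _
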